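{- Let $V$ be a stochastic valuation and $P$ a probability assignment on $L$. Then $\check{\widehat V}=V$ (as stochastic valuations, i.e. they have the same finite-dimensional distributions) and $\widehat{\check P}=P$.
   Context: $B=\{B_j: j\in\mathbb N\}$ is a denumerable set of propositional symbols and $L$ is the set of propositional formulas generated from $B$ by $\neg$ and $\supset$ (other connectives are the usual abbreviations). A valuation $v:B\to\{0,1\}$ is identified with the subset $\{B_j: v(B_j)=1\}$ of $B$; $v\Vdash_c\alpha$ is classical satisfaction and $\vDash_c$ classical entailment. $B_\alpha$ is the set of symbols occurring in $\alpha$ and $[\![\alpha]\!]=\{v\cap B_\alpha : v\Vdash_c\alpha\}$. A probability assignment is a map $P$ from $L$ to the reals such that for all $\alpha,\beta\in L$: (P1) $0\le P(\alpha)\le1$; (P2) if $\vDash_c\alpha$ then $P(\alpha)=1$; (P3) if $\alpha\vDash_c\beta$ then $P(\alpha)\le P(\beta)$; (P4) if $\vDash_c\neg(\beta\wedge\alpha)$ then $P(\beta\vee\alpha)=P(\beta)+P(\alpha)$. A stochastic valuation $V$ is a family $\{V_{B_j}\}_{B_j\in B}$ of random variables on a probability space $(\Omega,\mathcal F,\mu)$, where $V_{B_j}$ takes values in $\{\emptyset,\{B_j\}\}$ ($\emptyset$ for false, $\{B_j\}$ for true). For finite non-empty $A\subseteq B$ and $U\subseteq A$, $\mathrm{Prob}(V_A=U)=\mu\big(\bigcap_{B_j\in A}V_{B_j}^{ -1}(U\cap\{B_j\})\big)$. Two stochastic valuations are identified when all these finite-dimensional distributions coincide. For $\alpha\in L$,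 $\mathrm{Prob}_V(\alpha)=\sum_{U\in[\![\alpha]\!]}\mathrm{Prob}(V_{B_\alpha}=U)$. For a stochastic valuation $V$, $\widehat V$ is the map $\alpha\mapsto\mathrm{Prob}_V(\alpha)$ on $L$ (it is a probability assignment). For a probability assignment $P$, $\check P$ is the stochastic valuation, unique up to finite-dimensional distributions, such that $\mathrm{Prob}(\check P_A=U)=P(\phi_A^U)$ for every non-empty finite $A\subseteq B$ and $U\subseteq A$, where $\phi_A^U$ is the formula $\big(\bigwedge_{B_j\in U}B_j\big)\wedge\big(\bigwedge_{B_j\in A\setminus U}\neg B_j\big)$. -}

module Defs where

open import Level using (0ℓ) renaming (suc to lsuc)
open import Function using (_∘_; id; _⇔_; mk⇔)
open import Data.Bool as Bool using (Bool; true; false; not)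
open import Data.Bool.Properties using (not-¬; ¬-not)
open import Data.Nat as ℕ using (ℕ; zero; suc; _⊔_; z≤n; s≤s)
import Data.Nat.Properties as ℕ
open import Data.Rational as ℚ using (ℚ; 0ℚ; 1ℚ; ½)
import Data.Rational.Properties as ℚ
import Data.Rational.Solver as ℚ
open import Data.Product using (∃; _×_; _,_; proj₁; proj₂; swap)
open import Data.Sum using (_⊎_; inj₁; inj₂)
open import Data.Empty using (⊥-elim)
open import Data.List using (List; []; _∷_; _++_; [_]; map; foldr; filter; deduplicate; applyUpTo)
import Data.List.Properties as List
open import Data.List.Membership.Propositional using (_∈_; _∉_)
open import Data.List.Membership.Propositional.Properties using (∈-++⁺ˡ; ∈-++⁺ʳ; ∈-++⁻; ∈-map⁺; ∈-map⁻; ∈-filter⁺; ∈-filter⁻; ∈-deduplicate⁺)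
open import Data.List.Membership.DecPropositional ℕ._≟_ using (_∈?_; _∉?_)
open import Data.List.Relation.Binary.Subset.Propositional using (_⊆_)
open import Data.List.Relation.Unary.All as All using (All; []; _∷_)
open import Data.List.Relation.Unary.AllPairs using ([]; _∷_)
open import Data.List.Relation.Unary.Any using (here; there)
open import Data.List.Relation.Unary.Unique.Propositional using (Unique)
import Data.List.Relation.Unary.Unique.Propositional.Properties as Unique
open import Data.List.Relation.Unary.Unique.DecPropositional.Properties ℕ._≟_ using (deduplicate-!)
open import Relation.Nullary using (¬_; Dec; yes; no; does; ¬?; _×-dec_)
open import Relation.Nullary.Decidable using (decidable-stable; dec-true; dec-false; toSum)
open import Relation.Unary using (Pred; Decidable; _≐_; ∁; ⋃; ∅; _⊥_; _∩_; _∪_) renaming (U to full)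
open import Relation.Binary using (Poset)
open import Relation.Binary.PropositionalEquality using (_≡_; _≢_; refl; sym; trans; cong; cong₂; subst)
open import Algebra.Bundles using (CommutativeMonoid)
import Relation.Binary.Reasoning.PartialOrder as PosetReasoning

------------------------------------------------------------------------
-- Real numbers, as Cauchy sequences of rationals.  Nothing below multiplies
-- reals, so only the ordered additive structure is developed.

record ℝ : Set where
  constructor mkℝ
  field
    seq    : ℕ → ℚ
    cauchy : ∀ {ε} → 0ℚ ℚ.< ε →
             ∃ λ N → ∀ m n → N ℕ.≤ m → N ℕ.≤ n → ℚ.∣ seq m ℚ.- seq n ∣ ℚ.≤ ε

open ℝ

infix  4 _≤_ _≃_
infixl 6 _+_

_≤_ : ℝ → ℝ → Set
x ≤ y = ∀ {ε} → 0ℚ ℚ.< ε → ∃ λ N → ∀ n → N ℕ.≤ n → seq x n ℚ.≤ seq y n ℚ.+ ε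

-- Equality of reals: equivalently, x ≃ y says that the difference of the sequences tends to 0.
_≃_ : ℝ → ℝ → Set
x ≃ y = x ≤ y × y ≤ x

half-pos : ∀ {ε} → 0ℚ ℚ.< ε → 0ℚ ℚ.< ½ ℚ.* ε
half-pos {ε} p = ℚ.positive⁻¹ (½ ℚ.* ε) {{ℚ.pos*pos⇒pos ½ ε {{ℚ.positive p}}}}

half+half : ∀ ε → ½ ℚ.* ε ℚ.+ ½ ℚ.* ε ≡ ε
half+half ε = trans (sym (ℚ.*-distribʳ-+ ε ½ ½)) (ℚ.*-identityˡ ε)

ι : ℚ → ℝ
ι q = mkℝ (λ _ → q) λ 0<ε → 0 , λ _ _ _ _ →
  ℚ.≤-trans (ℚ.≤-reflexive (cong ℚ.∣_∣ (ℚ.+-inverseʳ q))) (ℚ.<⇒≤ 0<ε)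

0ℝ 1ℝ : ℝ
0ℝ = ι 0ℚ
1ℝ = ι 1ℚ

_+_ : ℝ → ℝ → ℝ
seq (x + y) n = seq x n ℚ.+ seq y n
cauchy (x + y) {ε} 0<ε with cauchy x (half-pos 0<ε) | cauchy y (half-pos 0<ε)
... | M , p | N , q = M ⊔ N , λ m n m≥ n≥ → begin
  ℚ.∣ (seq x m ℚ.+ seq y m) ℚ.- (seq x n ℚ.+ seq y n) ∣
    ≡⟨ cong ℚ.∣_∣ (shuffle (seq x m) (seq y m) (seq x n) (seq y n)) ⟩
  ℚ.∣ (seq x m ℚ.- seq x n) ℚ.+ (seq y m ℚ.- seq y n) ∣
    ≤⟨ ℚ.∣p+q∣≤∣p∣+∣q∣ (seq x m ℚ.- seq x n) (seq y m ℚ.- seq y n) ⟩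
  ℚ.∣ seq x m ℚ.- seq x n ∣ ℚ.+ ℚ.∣ seq y m ℚ.- seq y n ∣
    ≤⟨ ℚ.+-mono-≤ (p m n (ℕ.m⊔n≤o⇒m≤o M N m≥) (ℕ.m⊔n≤o⇒m≤o M N n≥))
                  (q m n (ℕ.m⊔n≤o⇒n≤o M N m≥) (ℕ.m⊔n≤o⇒n≤o M N n≥)) ⟩
  ½ ℚ.* ε ℚ.+ ½ ℚ.* ε
    ≡⟨ half+half ε ⟩
  ε ∎
  where
  open ℚ.≤-Reasoning
  shuffle : ∀ a b c d → (a ℚ.+ b) ℚ.- (c ℚ.+ d) ≡ (a ℚ.- c) ℚ.+ (b ℚ.- d)
  shuffle = solve 4 (λ a b c d → (a :+ b) :- (c :+ d) := (a :- c) :+ (b :- d)) refl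
    where open ℚ.+-*-Solver

≡⇒≤ : ∀ {x y} → (∀ n → seq x n ≡ seq y n) → x ≤ y
≡⇒≤ {x} {y} eq {ε} 0<ε = 0 , λ n _ → begin
  seq x n         ≡⟨ eq n ⟩
  seq y n         ≡⟨ ℚ.+-identityʳ (seq y n) ⟨
  seq y n ℚ.+ 0ℚ  ≤⟨ ℚ.+-monoʳ-≤ (seq y n) (ℚ.<⇒≤ 0<ε) ⟩
  seq y n ℚ.+ ε   ∎
  where open ℚ.≤-Reasoning

≡⇒≃ : ∀ {x y} → (∀ n → seq x n ≡ seq y n) → x ≃ y
≡⇒≃ {x} {y} eq = ≡⇒≤ {x} {y} eq , ≡⇒≤ {y} {x} (sym ∘ eq)

≤-refl : ∀ {x} → x ≤ x
≤-refl {x} = ≡⇒≤ {x} {x} (λ _ → refl)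

≤-trans : ∀ {x y z} → x ≤ y → y ≤ z → x ≤ z
≤-trans {x} {y} {z} x≤y y≤z {ε} 0<ε with x≤y (half-pos 0<ε) | y≤z (half-pos 0<ε)
... | M , p | N , q = M ⊔ N , λ n n≥ → begin
  seq x n
    ≤⟨ p n (ℕ.m⊔n≤o⇒m≤o M N n≥) ⟩
  seq y n ℚ.+ ½ ℚ.* ε
    ≤⟨ ℚ.+-monoˡ-≤ (½ ℚ.* ε) (q n (ℕ.m⊔n≤o⇒n≤o M N n≥)) ⟩
  seq z n ℚ.+ ½ ℚ.* ε ℚ.+ ½ ℚ.* ε
    ≡⟨ ℚ.+-assoc (seq z n) (½ ℚ.* ε) (½ ℚ.* ε) ⟩
  seq z n ℚ.+ (½ ℚ.* ε ℚ.+ ½ ℚ.* ε)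
    ≡⟨ cong (seq z n ℚ.+_) (half+half ε) ⟩
  seq z n ℚ.+ ε ∎
  where open ℚ.≤-Reasoning

+-mono-≤ : ∀ {x y u v} → x ≤ y → u ≤ v → x + u ≤ y + v
+-mono-≤ {x} {y} {u} {v} x≤y u≤v {ε} 0<ε with x≤y (half-pos 0<ε) | u≤v (half-pos 0<ε)
... | M , p | N , q = M ⊔ N , λ n n≥ → begin
  seq x n ℚ.+ seq u n
    ≤⟨ ℚ.+-mono-≤ (p n (ℕ.m⊔n≤o⇒m≤o M N n≥)) (q n (ℕ.m⊔n≤o⇒n≤o M N n≥)) ⟩
  (seq y n ℚ.+ ½ ℚ.* ε) ℚ.+ (seq v n ℚ.+ ½ ℚ.* ε)
    ≡⟨ shuffle (seq y n) (½ ℚ.* ε) (seq v n) ⟩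
  seq y n ℚ.+ seq v n ℚ.+ (½ ℚ.* ε ℚ.+ ½ ℚ.* ε)
    ≡⟨ cong (seq y n ℚ.+ seq v n ℚ.+_) (half+half ε) ⟩
  seq y n ℚ.+ seq v n ℚ.+ ε ∎
  where
  open ℚ.≤-Reasoning
  shuffle : ∀ a h b → (a ℚ.+ h) ℚ.+ (b ℚ.+ h) ≡ a ℚ.+ b ℚ.+ (h ℚ.+ h)
  shuffle = solve 3 (λ a h b → (a :+ h) :+ (b :+ h) := a :+ b :+ (h :+ h)) refl
    where open ℚ.+-*-Solver

+-cancelˡ-≤ : ∀ x {y z} → x + y ≤ x + z → y ≤ z
+-cancelˡ-≤ x {y} {z} le {ε} 0<ε with le 0<ε
... | N , p = N , λ n n≥ → begin
  seq y n                                           ≡⟨ left (seq x n) (seq y n) ⟩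
  ℚ.- seq x n ℚ.+ (seq x n ℚ.+ seq y n)             ≤⟨ ℚ.+-monoʳ-≤ (ℚ.- seq x n) (p n n≥) ⟩
  ℚ.- seq x n ℚ.+ (seq x n ℚ.+ seq z n ℚ.+ ε)       ≡⟨ right (seq x n) (seq z n) ε ⟩
  seq z n ℚ.+ ε                                     ∎
  where
  open ℚ.≤-Reasoning
  left : ∀ a b → b ≡ ℚ.- a ℚ.+ (a ℚ.+ b)
  left = solve 2 (λ a b → b := :- a :+ (a :+ b)) refl
    where open ℚ.+-*-Solver
  right : ∀ a b e → ℚ.- a ℚ.+ (a ℚ.+ b ℚ.+ e) ≡ b ℚ.+ e
  right = solve 3 (λ a b e → :- a :+ (a :+ b :+ e) := b :+ e) refl
    where open ℚ.+-*-Solver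

≤-closed : ∀ {x y} → (∀ {ε} → 0ℚ ℚ.< ε → x ≤ y + ι ε) → x ≤ y
≤-closed {x} {y} le {ε} 0<ε with le (half-pos 0<ε) (half-pos 0<ε)
... | N , p = N , λ n n≥ → ℚ.≤-trans (p n n≥) (ℚ.≤-reflexive
  (trans (ℚ.+-assoc (seq y n) (½ ℚ.* ε) (½ ℚ.* ε)) (cong (seq y n ℚ.+_) (half+half ε))))

ℝ-poset : Poset 0ℓ 0ℓ 0ℓ
ℝ-poset = record
  { Carrier = ℝ ; _≈_ = _≃_ ; _≤_ = _≤_
  ; isPartialOrder = record
    { isPreorder = record
      { isEquivalence = record
        { refl  = λ {x} → ≤-refl {x} , ≤-refl {x}
        ; sym   = swap
        ; trans = λ {x} {y} {z} (p , p′) (q , q′) → ≤-trans {x} {y} {z} p q , ≤-trans {z} {y} {x} q′ p′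
        }
      ; reflexive = proj₁
      ; trans = λ {x} {y} {z} → ≤-trans {x} {y} {z}
      }
    ; antisym = _,_
    }
  }

open Poset ℝ-poset using () renaming (isEquivalence to ≃-isEquivalence)

+-cong : ∀ {x y u v} → x ≃ y → u ≃ v → x + u ≃ y + v
+-cong {x} {y} {u} {v} (p , p′) (q , q′) =
  +-mono-≤ {x} {y} {u} {v} p q , +-mono-≤ {y} {x} {v} {u} p′ q′

+-0-commutativeMonoid : CommutativeMonoid 0ℓ 0ℓ
+-0-commutativeMonoid = record
  { Carrier = ℝ ; _≈_ = _≃_ ; _∙_ = _+_ ; ε = 0ℝ
  ; isCommutativeMonoid = record
    { isMonoid = record
      { isSemigroup = record
        { isMagma = record
          { isEquivalence = ≃-isEquivalence
          ; ∙-cong = λ {x} {y} {u} {v} → +-cong {x} {y} {u} {v}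
          }
        ; assoc = λ x y z → ≡⇒≃ {(x + y) + z} {x + (y + z)} λ n → ℚ.+-assoc (seq x n) (seq y n) (seq z n)
        }
      ; identity = (λ x → ≡⇒≃ {0ℝ + x} {x} (ℚ.+-identityˡ ∘ seq x))
                 , (λ x → ≡⇒≃ {x + 0ℝ} {x} (ℚ.+-identityʳ ∘ seq x))
      }
    ; comm = λ x y → ≡⇒≃ {x + y} {y + x} λ n → ℚ.+-comm (seq x n) (seq y n)
    }
  }

open CommutativeMonoid +-0-commutativeMonoid using ()
  renaming (refl to ≃-refl; sym to ≃-sym; trans to ≃-trans; reflexive to ≃-reflexive;
            identityˡ to +-identityˡ; identityʳ to +-identityʳ; assoc to +-assoc; comm to +-comm)

∑ : {A : Set} → List A → (A → ℝ) → ℝ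
∑ xs f = foldr _+_ 0ℝ (map f xs)

infix 4 _⟶_

_⟶_ : (ℕ → ℝ) → ℝ → Set
s ⟶ l = ∀ {ε} → 0ℚ ℚ.< ε → ∃ λ N → ∀ n → N ℕ.≤ n → s n ≤ l + ι ε × l ≤ s n + ι ε

HasSum : (ℕ → ℝ) → ℝ → Set
HasSum f l = (λ n → foldr _+_ 0ℝ (applyUpTo f n)) ⟶ l

module _ {A : Set} where

  ∑-cong : ∀ xs {f g : A → ℝ} → (∀ {x} → x ∈ xs → f x ≃ g x) → ∑ xs f ≃ ∑ xs g
  ∑-cong []       eq = ≃-refl {0ℝ}
  ∑-cong (x ∷ xs) {f} {g} eq =
    +-cong {f x} {g x} {∑ xs f} {∑ xs g} (eq (here refl)) (∑-cong xs (eq ∘ there))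

  ∑-++ : ∀ xs ys (f : A → ℝ) → ∑ (xs ++ ys) f ≃ ∑ xs f + ∑ ys f
  ∑-++ []       ys f = ≃-sym {0ℝ + ∑ ys f} {∑ ys f} (+-identityˡ (∑ ys f))
  ∑-++ (x ∷ xs) ys f = begin-equality
    f x + ∑ (xs ++ ys) f        ≈⟨ +-cong {f x} {f x} {∑ (xs ++ ys) f} {∑ xs f + ∑ ys f} (≃-refl {f x}) (∑-++ xs ys f) ⟩
    f x + (∑ xs f + ∑ ys f)     ≈⟨ +-assoc (f x) (∑ xs f) (∑ ys f) ⟨
    f x + ∑ xs f + ∑ ys f       ∎
    where open PosetReasoning ℝ-poset

  ∑-map : ∀ {B : Set} (h : A → B) xs (f : B → ℝ) → ∑ (map h xs) f ≃ ∑ xs (f ∘ h)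
  ∑-map h xs f = ≃-reflexive (cong (foldr _+_ 0ℝ) (sym (List.map-∘ xs)))

  ∑-filter : ∀ {P : Pred A 0ℓ} (P? : Decidable P) xs {f g : A → ℝ} →
             (∀ x → P x → f x ≃ g x) → (∀ x → ¬ P x → g x ≃ 0ℝ) →
             ∑ (filter P? xs) f ≃ ∑ xs g
  ∑-filter P? []       f≃g g≃0 = ≃-refl {0ℝ}
  ∑-filter P? (x ∷ xs) {f} {g} f≃g g≃0 with P? x
  ... | yes p = +-cong {f x} {g x} {∑ (filter P? xs) f} {∑ xs g} (f≃g x p) (∑-filter P? xs f≃g g≃0)
  ... | no ¬p = begin-equality
    ∑ (filter P? xs) f   ≈⟨ ∑-filter P? xs f≃g g≃0 ⟩
    ∑ xs g               ≈⟨ +-identityˡ (∑ xs g) ⟨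
    0ℝ + ∑ xs g          ≈⟨ +-cong {g x} {0ℝ} {∑ xs g} {∑ xs g} (g≃0 x ¬p) (≃-refl {∑ xs g}) ⟨
    g x + ∑ xs g         ∎
    where open PosetReasoning ℝ-poset

------------------------------------------------------------------------
-- Probability spaces

record ProbabilitySpace : Set₂ where
  field
    Ω : Set
    -- The level of F admits σ-algebras generated by a family of sets, whose
    -- definition quantifies over Pred Ω 0ℓ.
    F : Pred (Pred Ω 0ℓ) (lsuc 0ℓ)
    F-resp : ∀ {E E′} → E ≐ E′ → F E → F E′
    F-full : F full
    F-∁    : ∀ {E} → F E → F (∁ E)
    F-⋃    : ∀ {E : ℕ → Pred Ω 0ℓ} → (∀ n → F (E n)) → F (⋃ ℕ E)
    μ : ∀ E → F E → ℝ
    -- Sets are extensional: neither F nor μ distinguishes predicates with the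
    -- same elements, and μ does not depend on the proof of measurability.
    μ-resp   : ∀ {E E′} (e : F E) (e′ : F E′) → E ≐ E′ → μ E e ≃ μ E′ e′
    μ-nonneg : ∀ {E} (e : F E) → 0ℝ ≤ μ E e
    μ-full   : μ full F-full ≃ 1ℝ
    μ-⋃      : ∀ {E : ℕ → Pred Ω 0ℓ} (e : ∀ n → F (E n)) →
               (∀ {m n} → m ≢ n → E m ⊥ E n) →
               HasSum (λ n → μ (E n) (e n)) (μ (⋃ ℕ E) (F-⋃ e))

module ProbabilitySpaceProperties (S : ProbabilitySpace) where

  open ProbabilitySpace S

  F-∅ : F ∅
  F-∅ = F-resp ((λ ¬t → ¬t _) , (λ ())) (F-∁ F-full)

  pair : Pred Ω 0ℓ → Pred Ω 0ℓ → ℕ → Pred Ω 0ℓ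
  pair E D 0             = E
  pair E D 1             = D
  pair E D (suc (suc _)) = ∅

  F-pair : ∀ {E D} → F E → F D → ∀ n → F (pair E D n)
  F-pair e d 0             = e
  F-pair e d 1             = d
  F-pair e d (suc (suc _)) = F-∅

  ⋃-pair : ∀ {E D} → ⋃ ℕ (pair E D) ≐ E ∪ D
  ⋃-pair = (λ { (0 , x) → inj₁ x ; (1 , x) → inj₂ x })
         , (λ { (inj₁ x) → 0 , x ; (inj₂ x) → 1 , x })

  F-∪ : ∀ {E D} → F E → F D → F (E ∪ D)
  F-∪ e d = F-resp ⋃-pair (F-⋃ (F-pair e d))

  F-∩ : ∀ {E D} → Decidable E → Decidable D → F E → F D → F (E ∩ D)
  F-∩ {E} {D} E? D? e d = F-resp (to , from) (F-∁ (F-∪ (F-∁ e) (F-∁ d)))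
    where
    to : ∀ {ω} → ∁ (∁ E ∪ ∁ D) ω → (E ∩ D) ω
    to {ω} h = decidable-stable (E? ω) (h ∘ inj₁) , decidable-stable (D? ω) (h ∘ inj₂)
    from : ∀ {ω} → (E ∩ D) ω → ∁ (∁ E ∪ ∁ D) ω
    from (x , y) (inj₁ ¬x) = ¬x x
    from (x , y) (inj₂ ¬y) = ¬y y

  const-sum : ℝ → ℕ → ℝ
  const-sum c n = foldr _+_ 0ℝ (applyUpTo (λ _ → c) n)

  μ-∅ : μ ∅ F-∅ ≃ 0ℝ
  μ-∅ = ≤-closed {c} {0ℝ} bound , μ-nonneg F-∅
    where
    c = μ ∅ F-∅
    l = μ (⋃ ℕ (λ _ → ∅)) (F-⋃ (λ _ → F-∅))

    bound : ∀ {ε} → 0ℚ ℚ.< ε → c ≤ 0ℝ + ι ε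
    bound {ε} 0<ε with μ-⋃ (λ _ → F-∅) (λ _ → proj₁) (half-pos 0<ε)
    ... | N , p = +-cancelˡ-≤ (const-sum c N) {c} {0ℝ + ι ε} (begin
      const-sum c N + c                              ≈⟨ +-comm (const-sum c N) c ⟩
      c + const-sum c N                              ≤⟨ proj₁ (p (suc N) (ℕ.n≤1+n N)) ⟩
      l + ι δ                                        ≤⟨ +-mono-≤ {l} {const-sum c N + ι δ} {ι δ} {ι δ}
                                                          (proj₂ (p N ℕ.≤-refl)) (≤-refl {ι δ}) ⟩
      const-sum c N + ι δ + ι δ                      ≈⟨ +-assoc (const-sum c N) (ι δ) (ι δ) ⟩
      const-sum c N + (ι δ + ι δ)                    ≈⟨ +-cong {const-sum c N} {const-sum c N} {ι δ + ι δ} {0ℝ + ι ε}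
                                                          (≃-refl {const-sum c N})
                                                          (≡⇒≃ {ι δ + ι δ} {0ℝ + ι ε} λ _ →
                                                            trans (half+half ε) (sym (ℚ.+-identityˡ ε))) ⟩
      const-sum c N + (0ℝ + ι ε)                     ∎)
      where
      open PosetReasoning ℝ-poset
      δ = ½ ℚ.* ε

  μ-∪ : ∀ {E D} (e : F E) (d : F D) (u : F (E ∪ D)) → E ⊥ D → μ (E ∪ D) u ≃ μ E e + μ D d
  μ-∪ {E} {D} e d u E⊥D = begin-equality
    μ (E ∪ D) u    ≈⟨ μ-resp (F-⋃ (F-pair e d)) u ⋃-pair ⟨
    l              ≈⟨ ≤-closed {l} {s} l≤s , ≤-closed {s} {l} s≤l ⟩
    s              ∎
    where
    open PosetReasoning ℝ-poset
    l = μ (⋃ ℕ (pair E D)) (F-⋃ (F-pair e d))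
    s = μ E e + μ D d

    disjoint : ∀ {m n} → m ≢ n → pair E D m ⊥ pair E D n
    disjoint {0}           {0}           m≢n _       = m≢n refl
    disjoint {0}           {1}           m≢n (x , y) = E⊥D (x , y)
    disjoint {0}           {suc (suc _)} m≢n (x , ())
    disjoint {1}           {0}           m≢n (x , y) = E⊥D (y , x)
    disjoint {1}           {1}           m≢n _       = m≢n refl
    disjoint {1}           {suc (suc _)} m≢n (x , ())
    disjoint {suc (suc _)} {_}           m≢n (() , _)

    zeros : ∀ n → const-sum (μ ∅ F-∅) n ≃ 0ℝ
    zeros zero    = ≃-refl {0ℝ}
    zeros (suc n) = begin-equality
      μ ∅ F-∅ + const-sum (μ ∅ F-∅) n  ≈⟨ +-cong {μ ∅ F-∅} {0ℝ} {const-sum (μ ∅ F-∅) n} {0ℝ} μ-∅ (zeros n) ⟩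
      0ℝ + 0ℝ                          ≈⟨ +-identityˡ 0ℝ ⟩
      0ℝ                               ∎

    partial : ℕ → ℝ
    partial n = foldr _+_ 0ℝ (applyUpTo (λ i → μ (pair E D i) (F-pair e d i)) n)

    partial≃s : ∀ n → partial (suc (suc n)) ≃ s
    partial≃s n = +-cong {μ E e} {μ E e} {μ D d + const-sum (μ ∅ F-∅) n} {μ D d} (≃-refl {μ E e}) (begin-equality
      μ D d + const-sum (μ ∅ F-∅) n  ≈⟨ +-cong {μ D d} {μ D d} {const-sum (μ ∅ F-∅) n} {0ℝ} (≃-refl {μ D d}) (zeros n) ⟩
      μ D d + 0ℝ                     ≈⟨ +-identityʳ (μ D d) ⟩
      μ D d                          ∎)

    s≤l : ∀ {ε} → 0ℚ ℚ.< ε → s ≤ l + ι ε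
    s≤l {ε} 0<ε with μ-⋃ (F-pair e d) disjoint 0<ε
    ... | N , p = begin
      s                      ≈⟨ partial≃s N ⟨
      partial (suc (suc N))  ≤⟨ proj₁ (p (suc (suc N)) (ℕ.m≤n+m N 2)) ⟩
      l + ι ε                ∎

    l≤s : ∀ {ε} → 0ℚ ℚ.< ε → l ≤ s + ι ε
    l≤s {ε} 0<ε with μ-⋃ (F-pair e d) disjoint 0<ε
    ... | N , p = begin
      l                            ≤⟨ proj₂ (p (suc (suc N)) (ℕ.m≤n+m N 2)) ⟩
      partial (suc (suc N)) + ι ε  ≈⟨ +-cong {partial (suc (suc N))} {s} {ι ε} {ι ε} (partial≃s N) (≃-refl {ι ε}) ⟩
      s + ι ε                      ∎

  record DecEvent : Set₁ where
    field
      event      : Pred Ω 0ℓ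
      decidable  : Decidable event
      measurable : F event

  open DecEvent

  ℙ : DecEvent → ℝ
  ℙ E = μ (event E) (measurable E)

  fullᵈ : DecEvent
  fullᵈ = record { event = full ; decidable = λ _ → yes _ ; measurable = F-full }

  ∁ᵈ : DecEvent → DecEvent
  ∁ᵈ E = record
    { event = ∁ (event E) ; decidable = ¬? ∘ decidable E ; measurable = F-∁ (measurable E) }

  infixr 7 _∩ᵈ_

  _∩ᵈ_ : DecEvent → DecEvent → DecEvent
  E ∩ᵈ D = record
    { event      = event E ∩ event D
    ; decidable  = λ ω → decidable E ω ×-dec decidable D ω
    ; measurable = F-∩ (decidable E) (decidable D) (measurable E) (measurable D)
    }

  ℙ-cong : ∀ E D → event E ≐ event D → ℙ E ≃ ℙ D
  ℙ-cong E D = μ-resp (measurable E) (measurable D)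

  ℙ-empty : ∀ E → (∀ {ω} → ¬ event E ω) → ℙ E ≃ 0ℝ
  ℙ-empty E ¬E = ≃-trans {ℙ E} {μ ∅ F-∅} {0ℝ} (μ-resp (measurable E) F-∅ ((λ x → ⊥-elim (¬E x)) , (λ ()))) μ-∅

  ℙ-disjoint : ∀ E D C → event E ⊥ event D → event C ≐ event E ∪ event D → ℙ C ≃ ℙ E + ℙ D
  ℙ-disjoint E D C E⊥D C≐ = ≃-trans {ℙ C} {μ _ u} {ℙ E + ℙ D}
    (μ-resp (measurable C) u C≐) (μ-∪ (measurable E) (measurable D) u E⊥D)
    where u = F-∪ (measurable E) (measurable D)

  ℙ-split : ∀ E D → ℙ E ≃ ℙ (E ∩ᵈ D) + ℙ (E ∩ᵈ ∁ᵈ D)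
  ℙ-split E D = ℙ-disjoint (E ∩ᵈ D) (E ∩ᵈ ∁ᵈ D) E (λ ((_ , x) , (_ , ¬x)) → ¬x x)
    ( (λ {ω} x → Data.Sum.map (x ,_) (x ,_) (toSum (decidable D ω)))
    , (λ { (inj₁ (x , _)) → x ; (inj₂ (x , _)) → x }) )

  ℙ-mono : ∀ E D → (∀ {ω} → event E ω → event D ω) → ℙ E ≤ ℙ D
  ℙ-mono E D E⊆D = begin
    ℙ E                          ≈⟨ +-identityʳ (ℙ E) ⟨
    ℙ E + 0ℝ                     ≤⟨ +-mono-≤ {ℙ E} {ℙ E} {0ℝ} {ℙ (D ∩ᵈ ∁ᵈ E)}
                                      (≤-refl {ℙ E}) (μ-nonneg (measurable (D ∩ᵈ ∁ᵈ E))) ⟩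
    ℙ E + ℙ (D ∩ᵈ ∁ᵈ E)          ≈⟨ +-cong {ℙ E} {ℙ (D ∩ᵈ E)} {ℙ (D ∩ᵈ ∁ᵈ E)} {ℙ (D ∩ᵈ ∁ᵈ E)}
                                      (ℙ-cong E (D ∩ᵈ E) ((λ x → E⊆D x , x) , proj₂)) (≃-refl {ℙ (D ∩ᵈ ∁ᵈ E)}) ⟩
    ℙ (D ∩ᵈ E) + ℙ (D ∩ᵈ ∁ᵈ E)   ≈⟨ ℙ-split D E ⟨
    ℙ D                          ∎
    where open PosetReasoning ℝ-poset

------------------------------------------------------------------------
-- Propositional logic.  The symbol B_j is represented by the number j.

infix  9 ~_
infixr 7 _∧_
infixr 6 _∨_
infixr 5 _⊃_

data L : Set where
  var : ℕ → L
  ~_  : L → L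
  _⊃_ : L → L → L

_∨_ _∧_ : L → L → L
α ∨ β = ~ α ⊃ β
α ∧ β = ~ (α ⊃ ~ β)

verum : L
verum = var 0 ⊃ var 0

⋀ : List L → L
⋀ []           = verum
⋀ (α ∷ [])     = α
⋀ (α ∷ β ∷ αs) = α ∧ ⋀ (β ∷ αs)

Valuation : Set
Valuation = ℕ → Bool

eval : Valuation → L → Bool
eval v (var j) = v j
eval v (~ α)   = not (eval v α)
eval v (α ⊃ β) = not (eval v α) Bool.∨ eval v β

infix 4 _⊩_ _⊩?_ _⊨_ ⊨_

_⊩_ : Valuation → L → Set
v ⊩ α = eval v α ≡ true

_⊩?_ : ∀ v α → Dec (v ⊩ α)
v ⊩? α = eval v α Bool.≟ true

_⊨_ : L → L → Set
α ⊨ β = ∀ v → v ⊩ α → v ⊩ β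

⊨_ : L → Set
⊨ α = ∀ v → v ⊩ α

-- Finite sets of symbols are lists of numbers, in any order and possibly with
-- repetitions; collections that are summed over are listed without repetitions.

χ : List ℕ → Valuation
χ U j = does (j ∈? U)

_∩ˢ_ : Valuation → List ℕ → List ℕ
v ∩ˢ A = filter (λ j → v j Bool.≟ true) A

occurrences : L → List ℕ
occurrences (var j) = [ j ]
occurrences (~ α)   = occurrences α
occurrences (α ⊃ β) = occurrences α ++ occurrences β

symbols : L → List ℕ
symbols α = deduplicate ℕ._≟_ (occurrences α)

-- The subsets of a list without repetitions, each listed exactly once.
subsets : List ℕ → List (List ℕ)
subsets []      = [ [] ]
subsets (a ∷ A) = subsets A ++ map (a ∷_) (subsets A)

-- { v ∩ B_α : v ⊩ α }; see ∈-⟦⟧ and ⟦⟧-unique.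
⟦_⟧ : L → List (List ℕ)
⟦ α ⟧ = filter (λ U → χ U ⊩? α) (subsets (symbols α))

-- The formula φ_A^U.
φ : List ℕ → List ℕ → L
φ A U = ⋀ (map var U) ∧ ⋀ (map (~_ ∘ var) (filter (_∉? U) A))

χ-∈ : ∀ j U → j ∈ U → χ U j ≡ true
χ-∈ j U = dec-true (j ∈? U)

χ-∉ : ∀ j U → j ∉ U → χ U j ≡ false
χ-∉ j U = dec-false (j ∈? U)

eval-cong : ∀ {v w} α → (∀ {j} → j ∈ occurrences α → v j ≡ w j) → eval v α ≡ eval w α
eval-cong (var j) eq = eq (here refl)
eval-cong (~ α)   eq = cong not (eval-cong α eq)
eval-cong (α ⊃ β) eq = cong₂ (λ a b → not a Bool.∨ b)
  (eval-cong α (eq ∘ ∈-++⁺ˡ)) (eval-cong β (eq ∘ ∈-++⁺ʳ (occurrences α)))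

eval-cong-symbols : ∀ {v w} α → (∀ {j} → j ∈ symbols α → v j ≡ w j) → eval v α ≡ eval w α
eval-cong-symbols α eq = eval-cong α (eq ∘ ∈-deduplicate⁺ ℕ._≟_)

subsets-⊆ : ∀ A {U} → U ∈ subsets A → U ⊆ A
subsets-⊆ []      (here refl) ()
subsets-⊆ (a ∷ A) U∈ j∈U with ∈-++⁻ (subsets A) U∈
... | inj₁ U∈A = there (subsets-⊆ A U∈A j∈U)
... | inj₂ U∈map with ∈-map⁻ (a ∷_) U∈map | j∈U
...   | W , W∈ , refl | here refl = here refl
...   | W , W∈ , refl | there j∈W = there (subsets-⊆ A W∈ j∈W)

∩ˢ∈subsets : ∀ v A → v ∩ˢ A ∈ subsets A
∩ˢ∈subsets v []      = here refl
∩ˢ∈subsets v (a ∷ A) with v a Bool.≟ true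
... | yes _ = ∈-++⁺ʳ (subsets A) (∈-map⁺ (a ∷_) (∩ˢ∈subsets v A))
... | no  _ = ∈-++⁺ˡ (∩ˢ∈subsets v A)

∩ˢ-cong : ∀ {v w} A → (∀ {j} → j ∈ A → v j ≡ w j) → v ∩ˢ A ≡ w ∩ˢ A
∩ˢ-cong []      eq = refl
∩ˢ-cong {v} {w} (a ∷ A) eq with v a | w a | eq (here refl)
... | true  | true  | _ = cong (a ∷_) (∩ˢ-cong A (eq ∘ there))
... | false | false | _ = ∩ˢ-cong A (eq ∘ there)

χ-∷-≢ : ∀ {a j} U → j ≢ a → χ (a ∷ U) j ≡ χ U j
χ-∷-≢ {a} {j} U j≢a = helper (j ∈? U)
  where
  helper : Dec (j ∈ U) → χ (a ∷ U) j ≡ χ U j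
  helper (yes j∈U) = trans (χ-∈ j (a ∷ U) (there j∈U)) (sym (χ-∈ j U j∈U))
  helper (no  j∉U) = trans
    (χ-∉ j (a ∷ U) λ { (here j≡a) → j≢a j≡a ; (there j∈U) → j∉U j∈U }) (sym (χ-∉ j U j∉U))

∈-unique⇒≢ : ∀ {a j : ℕ} {A} → All (a ≢_) A → j ∈ A → j ≢ a
∈-unique⇒≢ a∉A j∈A j≡a = All.lookup a∉A j∈A (sym j≡a)

∈-subsets⇒∩ˢ : ∀ {A} → Unique A → ∀ {U} → U ∈ subsets A → U ≡ χ U ∩ˢ A
∈-subsets⇒∩ˢ {[]}    _           (here refl) = refl
∈-subsets⇒∩ˢ {a ∷ A} (a∉A ∷ A!) {U} U∈ with ∈-++⁻ (subsets A) U∈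
... | inj₁ U∈A = trans (∈-subsets⇒∩ˢ A! U∈A) (sym (List.filter-reject (λ j → χ U j Bool.≟ true) {x = a} {xs = A}
        λ t → not-¬ t (χ-∉ a U λ a∈U → ∈-unique⇒≢ a∉A (subsets-⊆ A U∈A a∈U) refl)))
... | inj₂ U∈map with ∈-map⁻ (a ∷_) U∈map
...   | W , W∈ , refl = sym (trans (List.filter-accept (λ j → χ (a ∷ W) j Bool.≟ true) {x = a} {xs = A} (χ-∈ a (a ∷ W) (here refl)))
        (cong (a ∷_) (trans (∩ˢ-cong A (λ j∈A → χ-∷-≢ W (∈-unique⇒≢ a∉A j∈A))) (sym (∈-subsets⇒∩ˢ A! W∈)))))

χ-∩ˢ : ∀ v {A j} → j ∈ A → χ (v ∩ˢ A) j ≡ v j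
χ-∩ˢ v {A} {j} j∈A = helper (v j) refl
  where
  helper : ∀ b → v j ≡ b → χ (v ∩ˢ A) j ≡ b
  helper true  eq = χ-∈ j (v ∩ˢ A) (∈-filter⁺ (λ i → v i Bool.≟ true) j∈A eq)
  helper false eq = χ-∉ j (v ∩ˢ A) λ j∈ → not-¬ (proj₂ (∈-filter⁻ (λ i → v i Bool.≟ true) {xs = A} j∈)) eq

∈-⟦⟧ : ∀ {U} α → U ∈ ⟦ α ⟧ ⇔ ∃ λ v → v ⊩ α × U ≡ v ∩ˢ symbols α
∈-⟦⟧ {U} α = mk⇔ to from
  where
  to : U ∈ ⟦ α ⟧ → ∃ λ v → v ⊩ α × U ≡ v ∩ˢ symbols α
  to U∈ with ∈-filter⁻ (λ W → χ W ⊩? α) {xs = subsets (symbols α)} U∈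
  ... | U∈subsets , sat = χ U , sat , ∈-subsets⇒∩ˢ (deduplicate-! (occurrences α)) U∈subsets
  from : (∃ λ v → v ⊩ α × U ≡ v ∩ˢ symbols α) → U ∈ ⟦ α ⟧
  from (v , sat , refl) = ∈-filter⁺ (λ W → χ W ⊩? α) (∩ˢ∈subsets v (symbols α))
    (trans (eval-cong-symbols α (χ-∩ˢ v)) sat)

subsets-unique : ∀ {A} → Unique A → Unique (subsets A)
subsets-unique {[]}    _          = [] ∷ []
subsets-unique {a ∷ A} (a∉A ∷ A!) = Unique.++⁺ (subsets-unique A!)
  (Unique.map⁺ List.∷-injectiveʳ (subsets-unique A!)) disjoint
  where
  disjoint : ∀ {U} → ¬ (U ∈ subsets A × U ∈ map (a ∷_) (subsets A))
  disjoint (U∈ , U∈map) with ∈-map⁻ (a ∷_) U∈map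
  ... | W , W∈ , refl = ∈-unique⇒≢ a∉A (subsets-⊆ A U∈ (here refl)) refl

⟦⟧-unique : ∀ α → Unique ⟦ α ⟧
⟦⟧-unique α = Unique.filter⁺ (λ U → χ U ⊩? α) (subsets-unique (deduplicate-! (occurrences α)))

------------------------------------------------------------------------
-- Probability assignments

record ProbabilityAssignment : Set where
  field
    P  : L → ℝ
    P1 : ∀ α → 0ℝ ≤ P α × P α ≤ 1ℝ
    P2 : ∀ α → ⊨ α → P α ≃ 1ℝ
    P3 : ∀ α β → α ⊨ β → P α ≤ P β
    P4 : ∀ α β → ⊨ ~ (β ∧ α) → P (β ∨ α) ≃ P β + P α

infix 4 _≃ᴾ_

_≃ᴾ_ : ProbabilityAssignment → ProbabilityAssignment → Set
P ≃ᴾ Q = ∀ α → ProbabilityAssignment.P P α ≃ ProbabilityAssignment.P Q α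

------------------------------------------------------------------------
-- Stochastic valuations

-- The value set {∅ , {B_j}} of V_{B_j} is represented by Bool, with true for
-- {B_j}.  The value U ∩ {B_j} is then χ U j.
record StochasticValuation : Set₂ where
  field
    space : ProbabilitySpace
  open ProbabilitySpace space
  field
    V          : ℕ → Ω → Bool
    measurable : ∀ j b → F (λ ω → V j ω ≡ b)

  open ProbabilitySpaceProperties space public hiding (pair)

  -- ⋂_{j ∈ A} V_j⁻¹ (U ∩ {B_j})
  cylinder : List ℕ → List ℕ → Pred Ω 0ℓ
  cylinder A U ω = All (λ j → V j ω ≡ χ U j) A

  cylinder? : ∀ A U → Decidable (cylinder A U)
  cylinder? A U ω = All.all? (λ j → V j ω Bool.≟ χ U j) A

  cylinder-measurable : ∀ A U → F (cylinder A U)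
  cylinder-measurable []      U = F-resp ((λ _ → []) , _) F-full
  cylinder-measurable (a ∷ A) U = F-resp ((λ (p , ps) → p ∷ ps) , (λ { (p ∷ ps) → p , ps }))
    (F-∩ (λ ω → V a ω Bool.≟ χ U a) (cylinder? A U) (measurable a (χ U a)) (cylinder-measurable A U))

  Prob : List ℕ → List ℕ → ℝ
  Prob A U = μ (cylinder A U) (cylinder-measurable A U)

  Probᴸ : L → ℝ
  Probᴸ α = ∑ ⟦ α ⟧ (Prob (symbols α))

-- Equality of stochastic valuations: equality of all Prob(V_A = U), for
-- ∅ ≠ A finite and U ⊆ A.
infix 4 _≃ⱽ_

_≃ⱽ_ : StochasticValuation → StochasticValuation → Set
V ≃ⱽ W = ∀ A U → A ≢ [] → U ⊆ A → StochasticValuation.Prob V A U ≃ StochasticValuation.Prob W A U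

------------------------------------------------------------------------
-- From stochastic valuations to probability assignments.  Probᴸ α is the
-- probability that the random classical valuation j ↦ V_{B_j} satisfies α,
-- and (P1)-(P4) follow from this.

module StochasticValuationProperties (W : StochasticValuation) where

  open StochasticValuation W
  open ProbabilitySpace space

  valᵈ : ℕ → Bool → DecEvent
  valᵈ j b = record
    { event = λ ω → V j ω ≡ b ; decidable = λ ω → V j ω Bool.≟ b ; measurable = measurable j b }

  cylinderᵈ : List ℕ → List ℕ → DecEvent
  cylinderᵈ A U = record
    { event = cylinder A U ; decidable = cylinder? A U ; measurable = cylinder-measurable A U }

  value : Ω → Valuation
  value ω j = V j ω

  sat-measurable : ∀ α → F (λ ω → value ω ⊩ α)
  sat-measurable (var j) = measurable j true
  sat-measurable (~ α)   = F-resp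
    ( (λ {ω} → ¬⇒not (eval (value ω) α)) , (λ {ω} → not⇒¬ (eval (value ω) α)) ) (F-∁ (sat-measurable α))
    where
    ¬⇒not : ∀ b → ¬ (b ≡ true) → not b ≡ true
    ¬⇒not true  h = ⊥-elim (h refl)
    ¬⇒not false h = refl
    not⇒¬ : ∀ b → not b ≡ true → ¬ (b ≡ true)
    not⇒¬ false _ ()
  sat-measurable (α ⊃ β) = F-resp
    ( (λ {ω} → to (eval (value ω) α) (eval (value ω) β))
    , (λ {ω} → from (eval (value ω) α) (eval (value ω) β)) ) (F-∪ (F-∁ (sat-measurable α)) (sat-measurable β))
    where
    to : ∀ a b → ¬ (a ≡ true) ⊎ b ≡ true → not a Bool.∨ b ≡ true
    to true  b (inj₁ h) = ⊥-elim (h refl)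
    to true  b (inj₂ h) = h
    to false b _        = refl
    from : ∀ a b → not a Bool.∨ b ≡ true → ¬ (a ≡ true) ⊎ b ≡ true
    from true  b h = inj₂ h
    from false b h = inj₁ λ ()

  satᵈ : L → DecEvent
  satᵈ α = record
    { event = λ ω → value ω ⊩ α ; decidable = λ ω → value ω ⊩? α ; measurable = sat-measurable α }

  total-probability : ∀ {A} → Unique A → ∀ E → ∑ (subsets A) (λ U → ℙ (E ∩ᵈ cylinderᵈ A U)) ≃ ℙ E
  total-probability {[]} _ E = begin-equality
    ℙ (E ∩ᵈ cylinderᵈ [] []) + 0ℝ  ≈⟨ +-identityʳ (ℙ (E ∩ᵈ cylinderᵈ [] [])) ⟩
    ℙ (E ∩ᵈ cylinderᵈ [] [])       ≈⟨ ℙ-cong (E ∩ᵈ cylinderᵈ [] []) E (proj₁ , (λ x → x , [])) ⟩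
    ℙ E                            ∎
    where open PosetReasoning ℝ-poset
  total-probability {a ∷ A} (a∉A ∷ A!) E = begin-equality
    ∑ (subsets A ++ map (a ∷_) (subsets A)) f
      ≈⟨ ∑-++ (subsets A) (map (a ∷_) (subsets A)) f ⟩
    ∑ (subsets A) f + ∑ (map (a ∷_) (subsets A)) f
      ≈⟨ +-cong {∑ (subsets A) f} {ℙ E₀} {∑ (map (a ∷_) (subsets A)) f} {ℙ E₁} part₀ part₁ ⟩
    ℙ E₀ + ℙ E₁
      ≈⟨ ℙ-disjoint E₀ E₁ E (λ { ((_ , p) , (_ , q)) → not-¬ q p }) (to , from) ⟨
    ℙ E ∎
    where
    open PosetReasoning ℝ-poset
    f = λ U → ℙ (E ∩ᵈ cylinderᵈ (a ∷ A) U)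
    E₀ = E ∩ᵈ valᵈ a false
    E₁ = E ∩ᵈ valᵈ a true
    open DecEvent

    to : ∀ {ω} → event E ω → event E₀ ω ⊎ event E₁ ω
    to {ω} x with V a ω
    ... | false = inj₁ (x , refl)
    ... | true  = inj₂ (x , refl)

    from : ∀ {ω} → event E₀ ω ⊎ event E₁ ω → event E ω
    from (inj₁ (x , _)) = x
    from (inj₂ (x , _)) = x

    part : ∀ (h : List ℕ → List ℕ) b →
           (∀ {U} → U ∈ subsets A → χ (h U) a ≡ b) →
           (∀ U {j} → j ∈ A → χ (h U) j ≡ χ U j) →
           ∑ (subsets A) (f ∘ h) ≃ ℙ (E ∩ᵈ valᵈ a b)
    part h b at-a off-a = begin-equality
      ∑ (subsets A) (f ∘ h)
        ≈⟨ ∑-cong (subsets A) (λ {U} U∈ → ℙ-cong (E ∩ᵈ cylinderᵈ (a ∷ A) (h U)) ((E ∩ᵈ valᵈ a b) ∩ᵈ cylinderᵈ A U)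
             ( (λ { (x , p ∷ ps) → (x , trans p (at-a U∈))
                                 , All.tabulate (λ j∈A → trans (All.lookup ps j∈A) (off-a U j∈A)) })
             , (λ { ((x , p) , ps) → x , trans p (sym (at-a U∈))
                                 ∷ All.tabulate (λ j∈A → trans (All.lookup ps j∈A) (sym (off-a U j∈A))) }) )) ⟩
      ∑ (subsets A) (λ U → ℙ ((E ∩ᵈ valᵈ a b) ∩ᵈ cylinderᵈ A U))
        ≈⟨ total-probability A! (E ∩ᵈ valᵈ a b) ⟩
      ℙ (E ∩ᵈ valᵈ a b) ∎

    part₀ : ∑ (subsets A) f ≃ ℙ E₀
    part₀ = part id false
      (λ {U} U∈ → χ-∉ a U λ a∈U → ∈-unique⇒≢ a∉A (subsets-⊆ A U∈ a∈U) refl) (λ _ _ → refl)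

    part₁ : ∑ (map (a ∷_) (subsets A)) f ≃ ℙ E₁
    part₁ = ≃-trans {∑ (map (a ∷_) (subsets A)) f} {∑ (subsets A) (f ∘ (a ∷_))} {ℙ E₁}
      (∑-map (a ∷_) (subsets A) f)
      (part (a ∷_) true (λ {U} _ → χ-∈ a (a ∷ U) (here refl)) (λ U j∈A → χ-∷-≢ U (∈-unique⇒≢ a∉A j∈A)))

  Probᴸ≃ℙ-sat : ∀ α → Probᴸ α ≃ ℙ (satᵈ α)
  Probᴸ≃ℙ-sat α = begin-equality
    ∑ ⟦ α ⟧ (Prob (symbols α))
      ≈⟨ ∑-filter (λ U → χ U ⊩? α) (subsets A)
           (λ U sat → ℙ-cong (cylinderᵈ A U) (satᵈ α ∩ᵈ cylinderᵈ A U)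
              ((λ c → trans (agree U c) sat , c) , proj₂))
           (λ U ¬sat → ℙ-empty (satᵈ α ∩ᵈ cylinderᵈ A U)
              λ { (sat , c) → ¬sat (trans (sym (agree U c)) sat) }) ⟩
    ∑ (subsets A) (λ U → ℙ (satᵈ α ∩ᵈ cylinderᵈ A U))
      ≈⟨ total-probability (deduplicate-! (occurrences α)) (satᵈ α) ⟩
    ℙ (satᵈ α) ∎
    where
    open PosetReasoning ℝ-poset
    A = symbols α
    agree : ∀ {ω} U → cylinder A U ω → eval (value ω) α ≡ eval (χ U) α
    agree U c = eval-cong-symbols α (All.lookup c)

infix 10 _^ _ˇ

_^ : StochasticValuation → ProbabilityAssignment
W ^ = record
  { P  = Probᴸ
  ; P1 = λ α → (begin
             0ℝ          ≤⟨ μ-nonneg (sat-measurable α) ⟩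
             ℙ (satᵈ α)  ≈⟨ Probᴸ≃ℙ-sat α ⟨
             Probᴸ α     ∎)
           , (begin
             Probᴸ α     ≈⟨ Probᴸ≃ℙ-sat α ⟩
             ℙ (satᵈ α)  ≤⟨ ℙ-mono (satᵈ α) fullᵈ _ ⟩
             ℙ fullᵈ     ≈⟨ μ-full ⟩
             1ℝ          ∎)
  ; P2 = λ α ⊨α → begin-equality
             Probᴸ α     ≈⟨ Probᴸ≃ℙ-sat α ⟩
             ℙ (satᵈ α)  ≈⟨ ℙ-cong (satᵈ α) fullᵈ (_ , (λ {ω} _ → ⊨α (value ω))) ⟩
             ℙ fullᵈ     ≈⟨ μ-full ⟩
             1ℝ          ∎
  ; P3 = λ α β α⊨β → begin
             Probᴸ α     ≈⟨ Probᴸ≃ℙ-sat α ⟩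
             ℙ (satᵈ α)  ≤⟨ ℙ-mono (satᵈ α) (satᵈ β) (λ {ω} → α⊨β (value ω)) ⟩
             ℙ (satᵈ β)  ≈⟨ Probᴸ≃ℙ-sat β ⟨
             Probᴸ β     ∎
  ; P4 = λ α β ⊨¬ → begin-equality
             Probᴸ (β ∨ α)            ≈⟨ Probᴸ≃ℙ-sat (β ∨ α) ⟩
             ℙ (satᵈ (β ∨ α))         ≈⟨ ℙ-disjoint (satᵈ β) (satᵈ α) (satᵈ (β ∨ α))
                                           (λ {ω} (b , a) → exclusive (eval (value ω) β) (eval (value ω) α) b a (⊨¬ (value ω)))
                                           ( (λ {ω} → to (eval (value ω) β) (eval (value ω) α))
                                           , (λ {ω} → from (eval (value ω) β) (eval (value ω) α)) ) ⟩
             ℙ (satᵈ β) + ℙ (satᵈ α)  ≈⟨ +-cong {Probᴸ β} {ℙ (satᵈ β)} {Probᴸ α} {ℙ (satᵈ α)}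
                                           (Probᴸ≃ℙ-sat β) (Probᴸ≃ℙ-sat α) ⟨
             Probᴸ β + Probᴸ α        ∎
  }
  where
  open PosetReasoning ℝ-poset
  open StochasticValuation W
  open StochasticValuationProperties W
  open ProbabilitySpace space

  exclusive : ∀ b a → b ≡ true → a ≡ true → ¬ (not (not (not b Bool.∨ not a)) ≡ true)
  exclusive true true _ _ ()
  to : ∀ b a → not (not b) Bool.∨ a ≡ true → b ≡ true ⊎ a ≡ true
  to true  a h = inj₁ refl
  to false a h = inj₂ h
  from : ∀ b a → b ≡ true ⊎ a ≡ true → not (not b) Bool.∨ a ≡ true
  from true  a _        = refl
  from false a (inj₂ h) = h

------------------------------------------------------------------------
-- From probability assignments to stochastic valuations.  Since stochastic
-- valuations are considered up to _≃ⱽ_, P ˇ is given as the class of those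
-- with the defining property of P̌; ˇ-unique says that it is a single class.
-- That it is inhabited is Kolmogorov's extension theorem.

_ˇ : ProbabilityAssignment → Pred StochasticValuation 0ℓ
(P ˇ) W = ∀ A U → A ≢ [] → U ⊆ A →
  StochasticValuation.Prob W A U ≃ ProbabilityAssignment.P P (φ A U)

ˇ-unique : ∀ P {V W} → (P ˇ) V → (P ˇ) W → V ≃ⱽ W
ˇ-unique P {V} {W} v w A U A≢[] U⊆A =
  ≃-trans {StochasticValuation.Prob V A U} {ProbabilityAssignment.P P (φ A U)} {StochasticValuation.Prob W A U}
    (v A U A≢[] U⊆A)
    (≃-sym {StochasticValuation.Prob W A U} {ProbabilityAssignment.P P (φ A U)} (w A U A≢[] U⊆A))

{-# OPTIONS --safe #-}
-- Under U ⊆ A, a classical valuation v satisfies φ_A^U iff v and U agree on A.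
-- Hence the event "the random valuation satisfies φ_A^U" is the cylinder
-- V_A = U, which gives the first half.  For the second half, (P4) yields a law
-- of total probability P(α) = Σ_{U ⊆ A} P(α ∧ φ_A^U); with A = B_α, the formula
-- α ∧ φ_A^U is equivalent to φ_A^U if U satisfies α and is contradictory otherwise.
module Submission where

open import Defs
open import Algebra.Bundles using (module CommutativeMonoid)
open import Function using (_∘_; id)
open import Data.Bool using (true; false; not)
open import Data.Bool.Properties using (not-¬)
open import Data.Nat as ℕ using (ℕ)
open import Data.Product using (∃; _×_; _,_; proj₁; proj₂)
open import Data.Empty using (⊥-elim)
open import Data.List using (List; []; _∷_; _++_; map; filter)
open import Data.List.Membership.Propositional using (_∈_)
open import Data.List.Membership.Propositional.Properties using (∈-++⁺ˡ; ∈-filter⁺; ∈-filter⁻; ∈-deduplicate⁺)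
open import Data.List.Membership.DecPropositional ℕ._≟_ using (_∈?_; _∉?_)
open import Data.List.Relation.Binary.Subset.Propositional using (_⊆_)
open import Data.List.Relation.Unary.All as All using (All; []; _∷_)
import Data.List.Relation.Unary.All.Properties as All
open import Data.List.Relation.Unary.AllPairs using ([]; _∷_)
open import Data.List.Relation.Unary.Any using (here; there)
open import Data.List.Relation.Unary.Unique.Propositional using (Unique)
open import Data.List.Relation.Unary.Unique.DecPropositional.Properties ℕ._≟_ using (deduplicate-!)
open import Relation.Binary using (Poset)
open import Relation.Binary.PropositionalEquality using (_≡_; _≢_; refl; sym; trans)
import Relation.Binary.Reasoning.PartialOrder as PosetReasoning
open import Relation.Nullary using (¬_; Dec; yes; no)
open import Relation.Unary using (_≐_)

open Poset ℝ-poset using (module Eq)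
module Monoid = CommutativeMonoid +-0-commutativeMonoid

-- Classical satisfaction of conjunctions and of `φ A U`.

not-true : ∀ {b} → b ≡ false → not b ≡ true
not-true refl = refl

true-not : ∀ {b} → not b ≡ true → b ≡ false
true-not {false} _ = refl

⊩-∧⁻ : ∀ v α β → v ⊩ α ∧ β → v ⊩ α × v ⊩ β
⊩-∧⁻ v α β h with eval v α | eval v β
... | true | true = refl , refl

⊩-∧⁺ : ∀ v α β → v ⊩ α → v ⊩ β → v ⊩ α ∧ β
⊩-∧⁺ v α β a b rewrite a | b = refl

⊩-verum : ∀ v → v ⊩ verum
⊩-verum v with v 0
... | true  = refl
... | false = refl

⊩-⋀⁻ : ∀ v αs → v ⊩ ⋀ αs → All (v ⊩_) αs
⊩-⋀⁻ v []           h = []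
⊩-⋀⁻ v (α ∷ [])     h = h ∷ []
⊩-⋀⁻ v (α ∷ β ∷ αs) h =
  let a , as = ⊩-∧⁻ v α (⋀ (β ∷ αs)) h in a ∷ ⊩-⋀⁻ v (β ∷ αs) as

⊩-⋀⁺ : ∀ v αs → All (v ⊩_) αs → v ⊩ ⋀ αs
⊩-⋀⁺ v []           _        = ⊩-verum v
⊩-⋀⁺ v (α ∷ [])     (a ∷ []) = a
⊩-⋀⁺ v (α ∷ β ∷ αs) (a ∷ as) = ⊩-∧⁺ v α (⋀ (β ∷ αs)) a (⊩-⋀⁺ v (β ∷ αs) as)

Agree : Valuation → List ℕ → List ℕ → Set
Agree v U A = All (λ j → v j ≡ χ U j) A

⊩-φ⁻ : ∀ v A U → v ⊩ φ A U → Agree v U A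
⊩-φ⁻ v A U h = All.tabulate λ {j} j∈A → agree j∈A (j ∈? U)
  where
  positive∧negative = ⊩-∧⁻ v (⋀ (map var U)) (⋀ (map (~_ ∘ var) (filter (_∉? U) A))) h
  positive = All.map⁻ (⊩-⋀⁻ v (map var U) (proj₁ positive∧negative))
  negative = All.map⁻ (⊩-⋀⁻ v (map (~_ ∘ var) (filter (_∉? U) A)) (proj₂ positive∧negative))

  agree : ∀ {j} → j ∈ A → Dec (j ∈ U) → v j ≡ χ U j
  agree {j} j∈A (yes j∈U) = trans (All.lookup positive j∈U) (sym (χ-∈ j U j∈U))
  agree {j} j∈A (no  j∉U) =
    trans (true-not (All.lookup negative (∈-filter⁺ (_∉? U) j∈A j∉U))) (sym (χ-∉ j U j∉U))

-- `U ⊆ A` enters through the positive conjuncts: they range over all of `U`, while agreement is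
-- known only on `A`.
⊩-φ⁺ : ∀ v A U → U ⊆ A → Agree v U A → v ⊩ φ A U
⊩-φ⁺ v A U U⊆A v≈U = ⊩-∧⁺ v (⋀ (map var U)) (⋀ (map (~_ ∘ var) (filter (_∉? U) A)))
  (⊩-⋀⁺ v (map var U) (All.map⁺ (All.tabulate λ {j} j∈U →
    trans (All.lookup v≈U (U⊆A j∈U)) (χ-∈ j U j∈U))))
  (⊩-⋀⁺ v (map (~_ ∘ var) (filter (_∉? U) A)) (All.map⁺ (All.tabulate λ {j} j∈ →
    let j∈A , j∉U = ∈-filter⁻ (_∉? U) {xs = A} j∈ in
    not-true (trans (All.lookup v≈U j∈A) (χ-∉ j U j∉U)))))

-- `φ (symbols α) U` fixes the truth value of every symbol of `α`, hence that of `α` itself.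
φ-⊨-eval : ∀ v α U → v ⊩ φ (symbols α) U → eval v α ≡ eval (χ U) α
φ-⊨-eval v α U h = eval-cong-symbols α (All.lookup (⊩-φ⁻ v (symbols α) U h))

∃-∈-occurrences : ∀ α → ∃ λ j → j ∈ occurrences α
∃-∈-occurrences (var j) = j , here refl
∃-∈-occurrences (~ α)   = ∃-∈-occurrences α
∃-∈-occurrences (α ⊃ β) = let j , j∈ = ∃-∈-occurrences α in j , ∈-++⁺ˡ j∈

-- The language has no propositional constants. The property defining `P ˇ` speaks of non-empty `A`
-- only, so this allows `A = symbols α`.
symbols≢[] : ∀ α → symbols α ≢ []
symbols≢[] α eq with symbols α | ∈-deduplicate⁺ ℕ._≟_ (proj₂ (∃-∈-occurrences α))
symbols≢[] α refl | [] | ()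

-- Additivity and total probability for probability assignments.

module ProbabilityAssignmentProperties (Q : ProbabilityAssignment) where

  open ProbabilityAssignment Q
  open PosetReasoning ℝ-poset

  P-cong : ∀ {α β} → α ⊨ β → β ⊨ α → P α ≃ P β
  P-cong {α} {β} α⊨β β⊨α = P3 α β α⊨β , P3 β α β⊨α

  -- (P3) in both directions makes `P` invariant under logical equivalence, so (P4) passes from
  -- `β ∨ γ` to any equivalent `α`.
  P-disjoint : ∀ α β γ → (∀ v → v ⊩ β → ¬ v ⊩ γ) →
               α ⊨ β ∨ γ → β ⊨ α → γ ⊨ α → P α ≃ P β + P γ
  P-disjoint α β γ disjoint α⊨β∨γ β⊨α γ⊨α = begin-equality
    P α         ≈⟨ P-cong {α} {β ∨ γ} α⊨β∨γ ∨⊨α ⟩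
    P (β ∨ γ)   ≈⟨ P4 γ β exclusive ⟩
    P β + P γ   ∎
    where
    ∨⊨α : β ∨ γ ⊨ α
    ∨⊨α v h with eval v β in eq
    ... | true  = β⊨α v eq
    ... | false = γ⊨α v h

    exclusive : ⊨ ~ (β ∧ γ)
    exclusive v with eval v β in b | eval v γ in c
    ... | true  | true  = ⊥-elim (disjoint v b c)
    ... | true  | false = refl
    ... | false | _     = refl

  -- An unsatisfiable `α` is vacuously disjoint from itself and equivalent to `α ∨ α`, so
  -- `P α + P α ≃ P α`. Cancelling one copy gives the upper bound; (P1) gives the lower one.
  P-contradiction : ∀ α → (∀ v → ¬ v ⊩ α) → P α ≃ 0ℝ
  P-contradiction α unsat =
    +-cancelˡ-≤ (P α) {P α} {0ℝ} (begin
      P α + P α   ≈⟨ P-disjoint α α α (λ v h → ⊥-elim (unsat v h))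
                       (λ v h → ⊥-elim (unsat v h)) (λ _ → id) (λ _ → id) ⟨
      P α         ≈⟨ Monoid.identityʳ (P α) ⟨
      P α + 0ℝ    ∎)
    , proj₁ (P1 α)

  -- Induction on `A`: subsets of `a ∷ A` omit or contain `a`, and the two halves of the sum add up
  -- to `P (α ∧ ~ var a)` and `P (α ∧ var a)`. The formula `α` changes in the recursive call.
  P-total : ∀ {A} → Unique A → ∀ α → ∑ (subsets A) (λ U → P (α ∧ φ A U)) ≃ P α
  P-total {[]} _ α = begin-equality
    -- `φ [] []` joins two empty conjunctions, each equal to `verum`, and is therefore valid.
    P (α ∧ φ [] []) + 0ℝ  ≈⟨ Monoid.identityʳ (P (α ∧ φ [] [])) ⟩
    P (α ∧ φ [] [])       ≈⟨ P-cong {α ∧ φ [] []} {α} (λ v → proj₁ ∘ ⊩-∧⁻ v α (φ [] []))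
                               (λ v h → ⊩-∧⁺ v α (φ [] []) h (⊩-φ⁺ v [] [] id [])) ⟩
    P α                   ∎
  P-total {a ∷ A} (a∉A ∷ A!) α = begin-equality
    ∑ (subsets A ++ map (a ∷_) (subsets A)) f
      ≈⟨ ∑-++ (subsets A) (map (a ∷_) (subsets A)) f ⟩
    ∑ (subsets A) f + ∑ (map (a ∷_) (subsets A)) f
      ≈⟨ Monoid.∙-cong {∑ (subsets A) f} {P α₀} {∑ (map (a ∷_) (subsets A)) f} {P α₁} part₀ part₁ ⟩
    P α₀ + P α₁
      ≈⟨ P-disjoint α α₀ α₁
           (λ v h₀ h₁ → not-¬ (true-not (proj₂ (⊩-∧⁻ v α (~ var a) h₀))) (proj₂ (⊩-∧⁻ v α (var a) h₁)))
           split (λ v → proj₁ ∘ ⊩-∧⁻ v α (~ var a)) (λ v → proj₁ ∘ ⊩-∧⁻ v α (var a)) ⟨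
    P α ∎
    where
    f  = λ U → P (α ∧ φ (a ∷ A) U)
    α₀ = α ∧ ~ var a
    α₁ = α ∧ var a

    split : α ⊨ α₀ ∨ α₁
    split v h rewrite h with v a
    ... | true  = refl
    ... | false = refl

    -- Treats both halves at once: `h` turns a subset of `A` into one of `a ∷ A`, `b` is the value
    -- it gives to `a`, and `l` is the literal expressing that value. Then `φ (a ∷ A) (h U)` is
    -- equivalent to `l ∧ φ A U`.
    part : ∀ (h : List ℕ → List ℕ) b l →
           (∀ v → v ⊩ l → v a ≡ b) → (∀ v → v a ≡ b → v ⊩ l) →
           (∀ {U} → U ∈ subsets A → χ (h U) a ≡ b) →
           (∀ U {j} → j ∈ A → χ (h U) j ≡ χ U j) →
           (∀ {U} → U ⊆ A → h U ⊆ a ∷ A) →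
           ∑ (subsets A) (f ∘ h) ≃ P (α ∧ l)
    part h b l l⁻ l⁺ at-a off-a h-⊆ = begin-equality
      ∑ (subsets A) (f ∘ h)
        ≈⟨ ∑-cong (subsets A) (λ {U} U∈ →
             P-cong {α ∧ φ (a ∷ A) (h U)} {(α ∧ l) ∧ φ A U} (to U∈) (from U∈)) ⟩
      ∑ (subsets A) (λ U → P ((α ∧ l) ∧ φ A U))
        ≈⟨ P-total A! (α ∧ l) ⟩
      P (α ∧ l) ∎
      where
      to : ∀ {U} → U ∈ subsets A → α ∧ φ (a ∷ A) (h U) ⊨ (α ∧ l) ∧ φ A U
      to {U} U∈ v s with ⊩-∧⁻ v α (φ (a ∷ A) (h U)) s
      ... | sα , sφ with ⊩-φ⁻ v (a ∷ A) (h U) sφ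
      ...   | p ∷ ps = ⊩-∧⁺ v (α ∧ l) (φ A U)
        (⊩-∧⁺ v α l sα (l⁺ v (trans p (at-a U∈))))
        (⊩-φ⁺ v A U (subsets-⊆ A U∈) (All.tabulate λ j∈A → trans (All.lookup ps j∈A) (off-a U j∈A)))

      from : ∀ {U} → U ∈ subsets A → (α ∧ l) ∧ φ A U ⊨ α ∧ φ (a ∷ A) (h U)
      from {U} U∈ v s with ⊩-∧⁻ v (α ∧ l) (φ A U) s
      ... | sαl , sφ with ⊩-∧⁻ v α l sαl | ⊩-φ⁻ v A U sφ
      ...   | sα , sl | ps = ⊩-∧⁺ v α (φ (a ∷ A) (h U)) sα
        (⊩-φ⁺ v (a ∷ A) (h U) (h-⊆ (subsets-⊆ A U∈))
          (trans (l⁻ v sl) (sym (at-a U∈))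
            ∷ All.tabulate λ j∈A → trans (All.lookup ps j∈A) (sym (off-a U j∈A))))

    part₀ : ∑ (subsets A) f ≃ P α₀
    part₀ = part id false (~ var a) (λ _ → true-not) (λ _ → not-true)
      (λ {U} U∈ → χ-∉ a U λ a∈U → ∈-unique⇒≢ a∉A (subsets-⊆ A U∈ a∈U) refl)
      (λ _ _ → refl) (λ U⊆A → there ∘ U⊆A)

    part₁ : ∑ (map (a ∷_) (subsets A)) f ≃ P α₁
    part₁ = begin-equality
      ∑ (map (a ∷_) (subsets A)) f     ≈⟨ ∑-map (a ∷_) (subsets A) f ⟩
      ∑ (subsets A) (f ∘ (a ∷_))       ≈⟨ part (a ∷_) true (var a) (λ _ → id) (λ _ → id)
        (λ {U} _ → χ-∈ a (a ∷ U) (here refl)) (λ U j∈A → χ-∷-≢ U (∈-unique⇒≢ a∉A j∈A))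
        (λ { U⊆A (here eq) → here eq ; U⊆A (there j∈U) → there (U⊆A j∈U) }) ⟩
      P α₁                             ∎

  P-∑-φ : ∀ α → ∑ ⟦ α ⟧ (P ∘ φ (symbols α)) ≃ P α
  P-∑-φ α = begin-equality
    ∑ ⟦ α ⟧ (P ∘ φ A)
      ≈⟨ ∑-filter (λ U → χ U ⊩? α) (subsets A)
           (λ U sat → P-cong {φ A U} {α ∧ φ A U}
              (λ v h → ⊩-∧⁺ v α (φ A U) (trans (φ-⊨-eval v α U h) sat) h)
              (λ v → proj₂ ∘ ⊩-∧⁻ v α (φ A U)))
           (λ U ¬sat → P-contradiction (α ∧ φ A U) λ v s →
              let sα , sφ = ⊩-∧⁻ v α (φ A U) s in ¬sat (trans (sym (φ-⊨-eval v α U sφ)) sα)) ⟩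
    ∑ (subsets A) (λ U → P (α ∧ φ A U))
      ≈⟨ P-total (deduplicate-! (occurrences α)) α ⟩
    P α ∎
    where A = symbols α

-- The two round trips.

^-ˇ : ∀ V → ((V ^) ˇ) V
^-ˇ V A U _ U⊆A = begin-equality
  Prob A U          ≈⟨ ℙ-cong (cylinderᵈ A U) (satᵈ (φ A U))
                         ( (λ {ω} → ⊩-φ⁺ (value ω) A U U⊆A) , (λ {ω} → ⊩-φ⁻ (value ω) A U)) ⟩
  -- `Probᴸ` sums over subsets of `symbols (φ A U)`, which may differ from `A`, for instance by the
  -- symbol 0 of `verum`. The event of satisfaction bridges the two.
  ℙ (satᵈ (φ A U))  ≈⟨ Probᴸ≃ℙ-sat (φ A U) ⟨
  Probᴸ (φ A U)     ∎
  where
  open StochasticValuation V hiding (V)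
  open StochasticValuationProperties V
  open PosetReasoning ℝ-poset

ˇ-^ : ∀ P W → (P ˇ) W → W ^ ≃ᴾ P
ˇ-^ P W w α = begin-equality
  -- The defining property of `P ˇ` is applied term by term; each `U` in `⟦ α ⟧` is a subset of the
  -- non-empty `symbols α`.
  Probᴸ α                     ≈⟨ ∑-cong ⟦ α ⟧ (λ {U} U∈ → w (symbols α) U (symbols≢[] α)
                                   (subsets-⊆ (symbols α)
                                     (proj₁ (∈-filter⁻ (λ U → χ U ⊩? α) {xs = subsets (symbols α)} U∈)))) ⟩
  ∑ ⟦ α ⟧ (ProbabilityAssignment.P P ∘ φ (symbols α))
                              ≈⟨ ProbabilityAssignmentProperties.P-∑-φ P α ⟩
  ProbabilityAssignment.P P α ∎
  where
  open StochasticValuation W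
  open PosetReasoning ℝ-poset

theorem2p10 : (V : StochasticValuation) (P : ProbabilityAssignment) →
    ((V ^) ˇ ≐ (V ≃ⱽ_)) × (∀ W → (P ˇ) W → W ^ ≃ᴾ P)
theorem2p10 V P =
  -- `V` and `W` both lie in the class `(V ^) ˇ`, whose members share their finite-dimensional
  -- distributions.
  ( (λ {W} w → ˇ-unique (V ^) {V} {W} (^-ˇ V) w)
  -- Conversely, equal distributions carry the defining property from `V` over to `W`.
  , (λ {W} V≃W A U A≢[] U⊆A →
      Eq.trans {StochasticValuation.Prob W A U} {StochasticValuation.Prob V A U} {StochasticValuation.Probᴸ V (φ A U)}
        (Eq.sym {StochasticValuation.Prob V A U} {StochasticValuation.Prob W A U} (V≃W A U A≢[] U⊆A))
        (^-ˇ V A U A≢[] U⊆A)) )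
  , ˇ-^ P
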